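{- Let $G'$ and $H$ be two non-trivial graphs such that $G'$ is connected ($H$ need not be connected). Then: 1. If $r(G' \circ H) \ge 2$, then $r(G' \circ H) \le rc(G' \circ H) \le 2\,r(G' \circ H)$. This bound is tight: there exist non-trivial graphs $G'$ and $H$, with $G'$ connected and $r(G'\circ H)\ge 2$, such that $rc(G' \circ H) = 2\,r(G' \circ H)$. 2. If $r(G' \circ H) = 1$, then $1 \le rc(G' \circ H) \le 3$. This bound is tight: there exist non-trivial graphs $G'$ and $H$, with $G'$ connected and $r(G'\circ H)=1$, such that $rc(G' \circ H) = 3$.
   Context: All graphs are finite, simple and undirected. A graph is trivial if it has order (number of vertices) 0 or 1, and non-trivial otherwise. For a connected graph $G$: $dist_G(u,v)$ is the length (number of edges) of a shortest path between $u$ and $v$; the eccentricity of a vertex $v$ is $ecc(v)=\max\{dist_G(v,u): u\in V(G)\}$; the radius is $r(G)=\min\{ecc(v): v\in V(G)\}$. An edge coloring of $G$ is any function from $E(G)$ to a set of colors (not necessarily proper). A path is a rainbow path if no two of its edges have the same color. An edge coloring is a rainbow coloring if every pair of vertices is connected by at least one rainbow path. The rainbow connection number $rc(G)$ of a connected graph $G$ is the minimum number of colors in a rainbow coloring of $G$. The lexicographic product $G \circ H$ has vertex set $V(G)\times V(H)$; two distinct vertices $[g_1,h_1]$ and $[g_2,h_2]$ are adjacent if and only if either $(g_1,g_2)\in E(G)$, or $g_1=g_2$ and $(h_1,h_2)\in E(H)$. (If $G$ is connected and non-trivial and $H$ is non-empty, then $G\circ H$ is connected.) -}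

module Defs where

open import Data.Nat.Base using (ℕ; zero; suc; _*_; _≤_; z≤n; s≤s)
import Data.Nat.Properties as ℕ
open import Data.Fin.Base using (Fin; zero; suc; combine; fromℕ<)
import Data.Fin.Properties as Fin
open import Data.List.Base using (List; []; _∷_; length; lookup)
open import Data.List.Relation.Unary.All as All using (All; []; _∷_)
import Data.List.Relation.Unary.All.Properties as All
open import Data.List.Relation.Unary.Any using (here; there)
open import Data.List.Relation.Unary.AllPairs using ([]; _∷_)
import Data.List.Relation.Unary.AllPairs as AllPairs
open import Data.List.Membership.Propositional using (_∈_)
import Data.List.Membership.DecPropositional as DecMembership
open import Data.List.Membership.Propositional.Properties using (∈-lookup)
open import Data.List.Relation.Unary.Unique.Propositional using (Unique)
open import Data.Vec.Base as Vec using (Vec; []; _∷_)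
import Data.Vec.Properties as Vec
open import Data.Product.Base using (Σ-syntax; ∃; ∃-syntax; _×_; _,_; proj₁; proj₂)
open import Data.Product.Function.NonDependent.Propositional using (_×-↔_)
open import Data.Sum.Base using (_⊎_; inj₁; inj₂; [_,_]′)
open import Data.Empty using (⊥-elim)
open import Function.Base using (case_of_)
open import Function.Bundles using (_↔_; Inverse)
open import Function.Properties.Inverse using (↔-sym; ↔-trans; ↔⇒↣)
open import Relation.Binary.Core using (Rel)
open import Relation.Binary.Definitions using (DecidableEquality)
open import Relation.Binary.PropositionalEquality
  using (_≡_; _≢_; refl; sym; trans; cong; cong₂; subst)
open import Relation.Nullary using (¬_; Dec; yes; no; contradiction)
open import Relation.Nullary.Decidable using (map′; ¬?; via-injection; _×-dec_; _⊎-dec_; _→-dec_)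
open import Relation.Unary using (Pred; Decidable)
open import Level using (0ℓ)

IsLeast : Pred ℕ 0ℓ → Pred ℕ 0ℓ
IsLeast P m = P m × (∀ n → P n → m ≤ n)

IsGreatest : Pred ℕ 0ℓ → Pred ℕ 0ℓ
IsGreatest P m = P m × (∀ n → P n → n ≤ m)

record Graph : Set₁ where
  infix 4 _~_ _~?_ _≟_
  field
    V        : Set
    order    : ℕ
    finite   : V ↔ Fin order
    _~_      : Rel V 0ℓ
    _~?_     : ∀ u v → Dec (u ~ v)
    ~-sym    : ∀ {u v} → u ~ v → v ~ u
    ~-irrefl : ∀ {v} → ¬ (v ~ v)

  _≟_ : DecidableEquality V
  _≟_ = via-injection (↔⇒↣ finite) Fin._≟_

NonTrivial : Graph → Set
NonTrivial G = 2 ≤ Graph.order G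

infixr 7 _∘_

_∘_ : Graph → Graph → Graph
G ∘ H = record
  { V        = G.V × H.V
  ; order    = G.order * H.order
  ; finite   = ↔-trans (G.finite ×-↔ H.finite) (↔-sym Fin.*↔×)
  ; _~_      = λ { (g₁ , h₁) (g₂ , h₂) → g₁ G.~ g₂ ⊎ (g₁ ≡ g₂ × h₁ H.~ h₂) }
  ; _~?_     = λ { (g₁ , h₁) (g₂ , h₂) → (g₁ G.~? g₂) ⊎-dec ((g₁ G.≟ g₂) ×-dec (h₁ H.~? h₂)) }
  ; ~-sym    = λ { (inj₁ e) → inj₁ (G.~-sym e)
                 ; (inj₂ (eq , e)) → inj₂ (sym eq , H.~-sym e) }
  ; ~-irrefl = λ { (inj₁ e) → G.~-irrefl e
                 ; (inj₂ (_ , e)) → H.~-irrefl e }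
  }
  where
  module G = Graph G
  module H = Graph H

module _ (G : Graph) where
  open Graph G

  infixr 5 _∷_

  data Walk : V → V → Set where
    []  : ∀ {v} → Walk v v
    _∷_ : ∀ {u w v} → u ~ w → Walk w v → Walk u v

  -- The value is required not to depend on the adjacency proof either: apply
  -- colour-sym twice.
  record Colouring (k : ℕ) : Set where
    field
      colour     : ∀ {u v} → u ~ v → Fin k
      colour-sym : ∀ {u v} (e : u ~ v) (e′ : v ~ u) → colour e ≡ colour e′

module _ {G : Graph} where
  open Graph G
  open Colouring

  vertices : ∀ {u v} → Walk G u v → List V
  vertices {u} []      = u ∷ []
  vertices {u} (_ ∷ w) = u ∷ vertices w

  walkLength : ∀ {u v} → Walk G u v → ℕ
  walkLength []      = 0
  walkLength (_ ∷ w) = suc (walkLength w)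

  colours : ∀ {k} → Colouring G k → ∀ {u v} → Walk G u v → List (Fin k)
  colours c []      = []
  colours c (e ∷ w) = colour c e ∷ colours c w

  IsPath : ∀ {u v} → Walk G u v → Set
  IsPath w = Unique (vertices w)

  IsRainbow : ∀ {k} → Colouring G k → ∀ {u v} → Walk G u v → Set
  IsRainbow c w = Unique (colours c w)

module _ (G : Graph) where
  open Graph G

  Path : V → V → Set
  Path u v = Σ[ w ∈ Walk G u v ] IsPath w

  Connected : Set
  Connected = ∀ u v → Path u v

  IsDistance : V → V → ℕ → Set
  IsDistance u v = IsLeast λ d → Σ[ p ∈ Path u v ] walkLength (proj₁ p) ≡ d

  -- Distances to unreachable vertices are left out here, so the eccentricity and
  -- the radius are meaningful only for connected graphs; existence and uniqueness
  -- for non-empty connected graphs are shown below.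
  IsEccentricity : V → ℕ → Set
  IsEccentricity v = IsGreatest λ d → ∃[ u ] IsDistance v u d

  IsRadius : ℕ → Set
  IsRadius = IsLeast λ e → ∃[ v ] IsEccentricity v e

  IsRainbowColouring : ∀ {k} → Colouring G k → Set
  IsRainbowColouring c = ∀ u v → Σ[ p ∈ Path u v ] IsRainbow c (proj₁ p)

  IsRainbowConnectionNumber : ℕ → Set
  IsRainbowConnectionNumber = IsLeast λ k → Σ[ c ∈ Colouring G k ] IsRainbowColouring c

least-unique : ∀ {P m n} → IsLeast P m → IsLeast P n → m ≡ n
least-unique (pm , m≤) (pn , n≤) = ℕ.≤-antisym (m≤ _ pn) (n≤ _ pm)

greatest-unique : ∀ {P m n} → IsGreatest P m → IsGreatest P n → m ≡ n
greatest-unique (pm , ≤m) (pn , ≤n) = ℕ.≤-antisym (≤n _ pm) (≤m _ pn)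

least-exists : ∀ {P : Pred ℕ 0ℓ} → Decidable P → ∃ P → ∃ (IsLeast P)
least-exists {P} P? (n , pn) = go P P? n pn
  where
  go : ∀ (P : Pred ℕ 0ℓ) → Decidable P → ∀ n → P n → ∃ (IsLeast P)
  go P P? zero    p = 0 , p , λ _ _ → z≤n
  go P P? (suc n) p with P? 0
  ... | yes p₀ = 0 , p₀ , λ _ _ → z≤n
  ... | no ¬p₀ with go (λ i → P (suc i)) (λ i → P? (suc i)) n p
  ...   | m , pm , m≤ = suc m , pm , λ { zero p₀ → contradiction p₀ ¬p₀
                                       ; (suc i) pi → s≤s (m≤ i pi) }

Searchable : Set → Set₁
Searchable A = ∀ {P : Pred A 0ℓ} → Decidable P → Dec (∃ P)

searchVec : ∀ {A} n → Searchable A → Searchable (Vec A n)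
searchVec zero    s P? = map′ (λ p → [] , p) (λ { ([] , p) → p }) (P? [])
searchVec (suc n) s P? =
  map′ (λ { (a , as , p) → a ∷ as , p }) (λ { (a ∷ as , p) → a , as , p })
       (s λ a → searchVec n s λ as → P? (a ∷ as))

chooseFin : ∀ n {A B : Pred (Fin n) 0ℓ} → (∀ i → A i ⊎ B i) → ∃ A ⊎ (∀ i → B i)
chooseFin zero    f = inj₂ λ ()
chooseFin (suc n) f with f zero
... | inj₁ a = inj₁ (zero , a)
... | inj₂ b with chooseFin n (λ i → f (suc i))
...   | inj₁ (i , a) = inj₁ (suc i , a)
...   | inj₂ bs      = inj₂ λ { zero → b ; (suc i) → bs i }

maxFin : ∀ {n} → Fin n → (f : Fin n → ℕ) → ∃[ i ] (∀ j → f j ≤ f i)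
maxFin {suc zero}    _ f = zero , λ { zero → ℕ.≤-refl }
maxFin {suc (suc n)} _ f with maxFin zero (λ i → f (suc i))
... | i , f≤ with ℕ.≤-total (f zero) (f (suc i))
...   | inj₁ le = suc i , λ { zero → le ; (suc j) → f≤ j }
...   | inj₂ ge = zero , λ { zero → ℕ.≤-refl ; (suc j) → ℕ.≤-trans (f≤ j) ge }

minFin : ∀ {n} → Fin n → (f : Fin n → ℕ) → ∃[ i ] (∀ j → f i ≤ f j)
minFin {suc zero}    _ f = zero , λ { zero → ℕ.≤-refl }
minFin {suc (suc n)} _ f with minFin zero (λ i → f (suc i))
... | i , ≤f with ℕ.≤-total (f zero) (f (suc i))
...   | inj₁ le = zero , λ { zero → ℕ.≤-refl ; (suc j) → ℕ.≤-trans le (≤f j) }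
...   | inj₂ ge = suc i , λ { zero → ge ; (suc j) → ≤f j }

unique-lookup : ∀ {A : Set} {xs : List A} → Unique xs →
                ∀ {i j} → lookup xs i ≡ lookup xs j → i ≡ j
unique-lookup (_ ∷ _)  {zero}  {zero}  _  = refl
unique-lookup (x ∷ _)  {zero}  {suc j} eq = contradiction eq (All.lookup x (∈-lookup j))
unique-lookup (x ∷ _)  {suc i} {zero}  eq = contradiction (sym eq) (All.lookup x (∈-lookup i))
unique-lookup (_ ∷ xs) {suc i} {suc j} eq = cong suc (unique-lookup xs eq)

module _ (G : Graph) where
  open Graph G
  open Inverse finite using (to; from; strictlyInverseˡ; strictlyInverseʳ)
  open Colouring
  open DecMembership _≟_ using (_∈?_)

  to-injective : ∀ {u v} → to u ≡ to v → u ≡ v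
  to-injective {u} {v} eq =
    trans (sym (strictlyInverseʳ u)) (trans (cong from eq) (strictlyInverseʳ v))

  choose : ∀ {A B : Pred V 0ℓ} → (∀ v → A v ⊎ B v) → ∃ A ⊎ (∀ v → B v)
  choose {B = B} f with chooseFin order (λ i → f (from i))
  ... | inj₁ (i , a) = inj₁ (from i , a)
  ... | inj₂ b       = inj₂ λ v → subst B (strictlyInverseʳ v) (b (to v))

  allV? : ∀ {P : Pred V 0ℓ} → Decidable P → Dec (∀ v → P v)
  allV? {P} P? with choose {λ v → ¬ P v} {P} (λ v → case P? v of λ { (yes p) → inj₂ p ; (no ¬p) → inj₁ ¬p })
  ... | inj₁ (v , ¬p) = no λ p → ¬p (p v)
  ... | inj₂ p        = yes p

  someV : 1 ≤ order → V
  someV 1≤n = from (fromℕ< 1≤n)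

  maxV : V → (f : V → ℕ) → ∃[ u ] (∀ v → f v ≤ f u)
  maxV v f with maxFin (to v) (λ i → f (from i))
  ... | i , ≤i = from i , λ u → subst (λ x → f x ≤ f (from i)) (strictlyInverseʳ u) (≤i (to u))

  minV : V → (f : V → ℕ) → ∃[ u ] (∀ v → f u ≤ f v)
  minV v f with minFin (to v) (λ i → f (from i))
  ... | i , i≤ = from i , λ u → subst (λ x → f (from i) ≤ f x) (strictlyInverseʳ u) (i≤ (to u))

  greatest-value : V → (Q : V → Pred ℕ 0ℓ) → (∀ {v m n} → Q v m → Q v n → m ≡ n) →
                   (∀ v → ∃ (Q v)) → ∃ (IsGreatest λ d → ∃[ v ] Q v d)
  greatest-value v Q unique value with maxV v (λ u → proj₁ (value u))
  ... | u , ≤u = proj₁ (value u) , (u , proj₂ (value u)) ,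
    λ { d (x , q) → subst (_≤ proj₁ (value u)) (unique (proj₂ (value x)) q) (≤u x) }

  least-value : V → (Q : V → Pred ℕ 0ℓ) → (∀ {v m n} → Q v m → Q v n → m ≡ n) →
                (∀ v → ∃ (Q v)) → ∃ (IsLeast λ d → ∃[ v ] Q v d)
  least-value v Q unique value with minV v (λ u → proj₁ (value u))
  ... | u , u≤ = proj₁ (value u) , (u , proj₂ (value u)) ,
    λ { d (x , q) → subst (proj₁ (value u) ≤_) (unique (proj₂ (value x)) q) (u≤ x) }

  colour-irrelevant : ∀ {k} (c : Colouring G k) {u v} (e e′ : u ~ v) → colour c e ≡ colour c e′
  colour-irrelevant c e e′ =
    trans (colour-sym c e (~-sym e)) (sym (colour-sym c e′ (~-sym e)))

  colours-cong : ∀ {k} (c d : Colouring G k) → (∀ {u v} (e : u ~ v) → colour c e ≡ colour d e) →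
                 ∀ {u v} (w : Walk G u v) → colours c w ≡ colours d w
  colours-cong c d eq []      = refl
  colours-cong c d eq (e ∷ w) = cong₂ _∷_ (eq e) (colours-cong c d eq w)

  length-vertices : ∀ {u v} (w : Walk G u v) → length (vertices w) ≡ suc (walkLength w)
  length-vertices []      = refl
  length-vertices (_ ∷ w) = cong suc (length-vertices w)

  path-bound : ∀ {u v} (p : Path G u v) → walkLength (proj₁ p) ≤ order
  path-bound (w , u) = ℕ.≤-trans (ℕ.n≤1+n _)
    (subst (_≤ order) (length-vertices w)
      (Fin.injective⇒≤ (λ eq → unique-lookup u (to-injective eq))))

  unique? : ∀ {A : Set} → DecidableEquality A → Decidable {A = List A} Unique
  unique? _≟ᴬ_ = AllPairs.allPairs? (λ x y → ¬? (x ≟ᴬ y))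

  -- Proofs of adjacency need not be unique, so searching is confined to walks
  -- built from the proofs that _~?_ returns.
  canon : ∀ {u v} → Walk G u v → Walk G u v
  canon []                  = []
  canon (_∷_ {u} {w} e p) with u ~? w
  ... | yes e′ = e′ ∷ canon p
  ... | no _   = e ∷ canon p

  canon-vertices : ∀ {u v} (w : Walk G u v) → vertices (canon w) ≡ vertices w
  canon-vertices []                = refl
  canon-vertices (_∷_ {u} {w} e p) with u ~? w
  ... | yes _ = cong (u ∷_) (canon-vertices p)
  ... | no _  = cong (u ∷_) (canon-vertices p)

  canon-length : ∀ {u v} (w : Walk G u v) → walkLength (canon w) ≡ walkLength w
  canon-length []                = refl
  canon-length (_∷_ {u} {w} e p) with u ~? w
  ... | yes _ = cong suc (canon-length p)
  ... | no _  = cong suc (canon-length p)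

  canon-colours : ∀ {k} (c : Colouring G k) {u v} (w : Walk G u v) →
                  colours c (canon w) ≡ colours c w
  canon-colours c []                = refl
  canon-colours c (_∷_ {u} {w} e p) with u ~? w
  ... | yes e′ = cong₂ _∷_ (colour-irrelevant c e′ e) (canon-colours c p)
  ... | no _   = cong (_ ∷_) (canon-colours c p)

  search : ∀ d {u v} {P : Pred (Walk G u v) 0ℓ} → Decidable P →
           ∃ P ⊎ (∀ w → walkLength w ≤ d → ¬ P (canon w))
  search zero {u} {v} P? with u ≟ v
  ... | no u≢v   = inj₂ λ { [] _ _ → u≢v refl }
  ... | yes refl with P? []
  ...   | yes p = inj₁ ([] , p)
  ...   | no ¬p = inj₂ λ { [] _ p → ¬p p }
  search (suc d) {u} {v} {P} P? with search zero P?
  ... | inj₁ found = inj₁ found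
  ... | inj₂ none₀ with choose step
    where
    step : ∀ w → ∃ P ⊎ (∀ (e : u ~ w) p → walkLength p ≤ d → ¬ P (canon (e ∷ p)))
    step w with u ~? w
    ... | no ¬e = inj₂ λ e → contradiction e ¬e
    ... | yes e with search d (λ p → P? (e ∷ p))
    ...   | inj₁ (p , found) = inj₁ (e ∷ p , found)
    ...   | inj₂ none        = inj₂ λ _ p → none p
  ...   | inj₁ (_ , found) = inj₁ found
  ...   | inj₂ none        = inj₂ λ { [] _ → none₀ [] z≤n
                                    ; (e ∷ p) (s≤s le) → none _ e p le }

  path? : ∀ {u v} {Q : Pred (Walk G u v) 0ℓ} → Decidable Q → (∀ w → Q w → Q (canon w)) →
          Dec (Σ[ p ∈ Path G u v ] Q (proj₁ p))
  path? {Q = Q} Q? resp with search order {P = λ w → IsPath w × Q w} (λ w → unique? _≟_ (vertices w) ×-dec Q? w)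
  ... | inj₁ (w , p , q) = yes ((w , p) , q)
  ... | inj₂ none        = no λ { ((w , p) , q) →
          none w (path-bound (w , p)) (subst Unique (sym (canon-vertices w)) p , resp w q) }

  rainbow? : ∀ {k} (c : Colouring G k) → Dec (IsRainbowColouring G c)
  rainbow? c = allV? λ u → allV? λ v →
    path? (λ w → unique? Fin._≟_ (colours c w)) (λ w → subst Unique (sym (canon-colours c w)))

  rainbow-cong : ∀ {k} (c d : Colouring G k) → (∀ {u v} (e : u ~ v) → colour c e ≡ colour d e) →
                 IsRainbowColouring G c → IsRainbowColouring G d
  rainbow-cong c d eq rb u v with rb u v
  ... | p , r = p , subst Unique (colours-cong c d eq (proj₁ p)) r

  colourable? : ∀ k → Dec (Σ[ c ∈ Colouring G k ] IsRainbowColouring G c)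
  colourable? zero with choose {B = λ u → ∀ v → ¬ (u ~ v)}
                          (λ u → choose {λ v → u ~ v} (λ v → case u ~? v of λ { (yes e) → inj₁ e ; (no ¬e) → inj₂ ¬e }))
  ... | inj₁ (_ , _ , e) = no λ { (c , _) → contradiction (colour c e) Fin.¬Fin0 }
  ... | inj₂ none        = map′ (c₀ ,_) (λ { (c , rb) → rainbow-cong c c₀ (λ e → ⊥-elim (none _ _ e)) rb }) (rainbow? c₀)
    where
    c₀ : Colouring G 0
    c₀ = record { colour     = λ e → ⊥-elim (none _ _ e)
                ; colour-sym = λ e → ⊥-elim (none _ _ e) }
  colourable? (suc k) =
    map′ (λ { (t , s , rb) → fromTable t s , rb }) (λ { (c , rb) → complete c rb })
         (searchVec order (searchVec order Fin.any?) valid?)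
    where
    Table : Set
    Table = Vec (Vec (Fin (suc k)) order) order

    at : Table → V → V → Fin (suc k)
    at t u v = Vec.lookup (Vec.lookup t (to u)) (to v)

    Symmetric : Table → Set
    Symmetric t = ∀ u v → u ~ v → at t u v ≡ at t v u

    fromTable : ∀ t → Symmetric t → Colouring G (suc k)
    fromTable t s = record { colour = λ {u} {v} _ → at t u v ; colour-sym = λ e _ → s _ _ e }

    Valid : Table → Set
    Valid t = Σ[ s ∈ Symmetric t ] IsRainbowColouring G (fromTable t s)

    valid? : Decidable Valid
    valid? t with allV? (λ u → allV? (λ v → (u ~? v) →-dec (at t u v Fin.≟ at t v u)))
    ... | no ¬s = no λ { (s , _) → ¬s s }
    ... | yes s = map′ (s ,_)
                       (λ { (s′ , rb) → rainbow-cong (fromTable t s′) (fromTable t s) (λ _ → refl) rb })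
                       (rainbow? (fromTable t s))

    complete : ∀ c → IsRainbowColouring G c → ∃ Valid
    complete c rb = t , s , rainbow-cong c (fromTable t s) (λ e → sym (at-t e)) rb
      where
      f : V → V → Fin (suc k)
      f u v with u ~? v
      ... | yes e = colour c e
      ... | no _  = zero

      f-edge : ∀ {u v} (e : u ~ v) → f u v ≡ colour c e
      f-edge {u} {v} e with u ~? v
      ... | yes e′ = colour-irrelevant c e′ e
      ... | no ¬e  = contradiction e ¬e

      t : Table
      t = Vec.tabulate λ i → Vec.tabulate λ j → f (from i) (from j)

      at-t : ∀ {u v} (e : u ~ v) → at t u v ≡ colour c e
      at-t {u} {v} e =
        trans (cong (λ row → Vec.lookup row (to v)) (Vec.lookup∘tabulate _ (to u)))
        (trans (Vec.lookup∘tabulate _ (to v))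
        (trans (cong₂ f (strictlyInverseʳ u) (strictlyInverseʳ v)) (f-edge e)))

      s : Symmetric t
      s u v e = trans (at-t e) (trans (colour-sym c e (~-sym e)) (sym (at-t (~-sym e))))

  code : V → V → Fin (order * order)
  code u v with Fin.≤-total (to u) (to v)
  ... | inj₁ _ = combine (to u) (to v)
  ... | inj₂ _ = combine (to v) (to u)

  code-ends : ∀ u v → code u v ≡ combine (to u) (to v) ⊎ code u v ≡ combine (to v) (to u)
  code-ends u v with Fin.≤-total (to u) (to v)
  ... | inj₁ _ = inj₁ refl
  ... | inj₂ _ = inj₂ refl

  code-sym : ∀ u v → code u v ≡ code v u
  code-sym u v with Fin.≤-total (to u) (to v) | Fin.≤-total (to v) (to u)
  ... | inj₁ p | inj₁ q = let eq = Fin.≤-antisym p q in cong₂ combine eq (sym eq)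
  ... | inj₁ _ | inj₂ _ = refl
  ... | inj₂ _ | inj₁ _ = refl
  ... | inj₂ p | inj₂ q = let eq = Fin.≤-antisym p q in cong₂ combine eq (sym eq)

  combine-inj : ∀ {i j k l : Fin order} → combine i j ≡ combine k l → i ≡ k × j ≡ l
  combine-inj {i} {j} {k} {l} = Fin.combine-injective i j k l

  code-∈ : ∀ {u v a b} → code u v ≡ code a b → u ≡ a ⊎ u ≡ b
  code-∈ {u} {v} {a} {b} eq with code-ends u v | code-ends a b
  ... | inj₁ p | inj₁ q = inj₁ (to-injective (proj₁ (combine-inj (trans (sym p) (trans eq q)))))
  ... | inj₁ p | inj₂ q = inj₂ (to-injective (proj₁ (combine-inj (trans (sym p) (trans eq q)))))
  ... | inj₂ p | inj₁ q = inj₂ (to-injective (proj₂ (combine-inj (trans (sym p) (trans eq q)))))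
  ... | inj₂ p | inj₂ q = inj₁ (to-injective (proj₂ (combine-inj (trans (sym p) (trans eq q)))))

  injective-colouring : Colouring G (order * order)
  injective-colouring = record { colour = λ {u} {v} _ → code u v ; colour-sym = λ _ _ → code-sym _ _ }

  path-rainbow : ∀ {u v} (w : Walk G u v) → IsPath w → IsRainbow injective-colouring w
  path-rainbow []                _        = []
  path-rainbow (_∷_ {u} {x} e w) (u∉ ∷ p) = fresh w u∉ ∷ path-rainbow w p
    where
    head-≢ : ∀ {a b} (w : Walk G a b) → All (u ≢_) (vertices w) → u ≢ a
    head-≢ []      (p ∷ _) = p
    head-≢ (_ ∷ _) (p ∷ _) = p

    fresh : ∀ {a b} (w : Walk G a b) → All (u ≢_) (vertices w) →
            All (code u x ≢_) (colours injective-colouring w)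
    fresh []      _        = []
    fresh (_ ∷ w) (p ∷ ps) =
      (λ eq → [ p , head-≢ w ps ]′ (code-∈ eq)) ∷ fresh w ps

  distance-exists : ∀ {u v} → Path G u v → ∃ (IsDistance G u v)
  distance-exists p = least-exists
    (λ d → path? (λ w → walkLength w ℕ.≟ d) (λ w → trans (canon-length w)))
    (walkLength (proj₁ p) , p , refl)

  eccentricity-exists : Connected G → ∀ v → ∃ (IsEccentricity G v)
  eccentricity-exists conn v =
    greatest-value v (IsDistance G v) least-unique (λ u → distance-exists (conn v u))

  radius-exists : 1 ≤ order → Connected G → ∃ (IsRadius G)
  radius-exists 1≤n conn =
    least-value (someV 1≤n) (IsEccentricity G) greatest-unique (eccentricity-exists conn)

  rainbowConnectionNumber-exists : Connected G → ∃ (IsRainbowConnectionNumber G)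
  rainbowConnectionNumber-exists conn = least-exists colourable?
    (_ , injective-colouring , λ u v → conn u v , path-rainbow _ (proj₂ (conn u v)))

  suffix : ∀ {u v x} (w : Walk G u v) → IsPath w → x ∈ vertices w → Path G x v
  suffix []      p       (here refl) = [] , p
  suffix (e ∷ w) p       (here refl) = e ∷ w , p
  suffix (_ ∷ w) (_ ∷ p) (there i)   = suffix w p i

  toPath : ∀ {u v} → Walk G u v → Path G u v
  toPath []      = [] , [] ∷ []
  toPath {u} (e ∷ w) with toPath w
  ... | w′ , p with u ∈? vertices w′
  ...   | yes i = suffix w′ p i
  ...   | no ¬i = e ∷ w′ , All.¬Any⇒All¬ _ ¬i ∷ p

  _++ʷ_ : ∀ {u v w} → Walk G u v → Walk G v w → Walk G u w
  []      ++ʷ q = q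
  (e ∷ p) ++ʷ q = e ∷ (p ++ʷ q)

  other : 2 ≤ order → ∀ v → ∃[ u ] v ≢ u
  other 2≤n v with choose {λ u → v ≢ u} {v ≡_} (λ u → case v ≟ u of λ { (yes p) → inj₂ p ; (no ¬p) → inj₁ ¬p })
  ... | inj₁ found = found
  ... | inj₂ same  = contradiction 2≤n (ℕ.≤⇒≯ (Fin.injective⇒≤ {f = λ _ → zero {0}} λ {i} {j} _ →
          trans (sym (strictlyInverseˡ i)) (trans (cong to (trans (sym (same _)) (same _))) (strictlyInverseˡ j))))

  neighbour : NonTrivial G → Connected G → ∀ v → ∃[ u ] v ~ u
  neighbour nt conn v with other nt v
  ... | u , v≢u with proj₁ (conn v u)
  ...   | []    = contradiction refl v≢u
  ...   | e ∷ _ = _ , e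

∘-nonTrivial : ∀ G H → NonTrivial G → NonTrivial H → NonTrivial (G ∘ H)
∘-nonTrivial G H nG nH = ℕ.≤-trans (s≤s (s≤s z≤n)) (ℕ.*-mono-≤ nG nH)

∘-connected : ∀ G H → NonTrivial G → Connected G → Connected (G ∘ H)
∘-connected G H nG conn (g₁ , h₁) (g₂ , h₂) with neighbour G nG conn g₂
... | g , e = toPath (G ∘ H) (_++ʷ_ (G ∘ H) (lift (proj₁ (conn g₁ g₂)))
                (_∷_ {w = g , h₁} (inj₁ e) (inj₁ (Graph.~-sym G e) ∷ [])))
  where
  lift : ∀ {a b} → Walk G a b → Walk (G ∘ H) (a , h₁) (b , h₁)
  lift []      = []
  lift (e ∷ w) = inj₁ e ∷ lift w

-- Let (g₀ , h₀) be a centre of G ∘ H and r ≥ 2 its eccentricity.  Slice G ∘ H into layers by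
-- the distance to g₀ in G, and split H into two sides, one of them a single vertex b.  The 2r
-- colours are the pairs (side, index).  Edges are coloured so that a vertex climbs to the hub
-- (g₀ , b) along a rainbow walk whose colours all have one prescribed side; climbs with
-- opposite sides concatenate to a rainbow walk.  Only vertices of layer 1 cannot choose the
-- side of their climb, and two of them on the same side are joined directly with four colours.
-- When r = 1 the product has a universal vertex, and a colouring by three vertex kinds works.
--
-- Both bounds are attained with H = K₂.  For G a path on five vertices the radius is 2 while
-- two vertices are at distance 4.  For G = K₁,₅ the product has two universal vertices, the
-- only common neighbours of leaves (i , 0) and (j , 0); with two colours, the edges to these
-- two are coloured alike for some i ≠ j, which leaves no rainbow walk.

module Submission where

open import Defs
open import Data.Nat.Base
  using (ℕ; zero; suc; _+_; _*_; _≤_; _<_; z≤n; s≤s; s≤s⁻¹; ∣_-_∣)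
import Data.Nat.Properties as ℕ
open import Data.Nat.DivMod using (_mod_; m<n⇒m%n≡m)
open import Data.Fin.Base using (Fin; zero; suc; toℕ; opposite; combine; remQuot)
import Data.Fin.Properties as Fin
open import Data.List.Base using (List; []; _∷_; _++_; length; reverse)
import Data.List.Properties as List
open import Data.List.Relation.Unary.All as All using (All; []; _∷_)
open import Data.List.Relation.Unary.Any using (here; there)
open import Data.List.Relation.Unary.AllPairs using ([]; _∷_)
open import Data.List.Membership.Propositional using (_∈_)
import Data.List.Membership.DecPropositional as DecMembership
open import Data.List.Relation.Unary.Unique.Propositional using (Unique)
import Data.List.Relation.Unary.Unique.Propositional.Properties as Unique
open import Data.List.Relation.Binary.Sublist.Propositional using (_⊆_; []; _∷_; _∷ʳ_; ⊆-refl; ⊆-trans)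
open import Data.List.Relation.Binary.Sublist.Propositional.Properties using (All-resp-⊆)
open import Data.List.Relation.Binary.Sublist.Heterogeneous.Properties using (length-mono-≤)
open import Data.List.Relation.Binary.Permutation.Propositional using (↭-sym; ↭⇒↭ₛ)
open import Data.List.Relation.Binary.Permutation.Propositional.Properties using (↭-reverse; ∈-resp-↭)
open import Data.List.Relation.Binary.Permutation.Setoid.Properties using (Unique-resp-↭)
open import Data.Product.Base using (Σ-syntax; ∃-syntax; _×_; _,_; proj₁; proj₂)
open import Data.Sum.Base using (_⊎_; inj₁; inj₂)
open import Data.Unit.Base using (⊤; tt)
open import Data.Empty using (⊥)
open import Data.Bool.Base using (if_then_else_)
open import Function.Properties.Inverse using (↔-refl)
open import Relation.Binary.Definitions using (tri<; tri≈; tri>)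
open import Relation.Binary.PropositionalEquality
  using (_≡_; _≢_; refl; sym; trans; cong; cong₂; subst; subst₂; setoid; ≢-sym)
open import Relation.Nullary using (¬_; Dec; yes; no; contradiction; does)
open import Relation.Nullary.Decidable using (dec-true; dec-false)

-- Colours and lengths of walks under reversal, concatenation and loop erasure.

Unique-resp-⊆ : ∀ {A : Set} {xs ys : List A} → xs ⊆ ys → Unique ys → Unique xs
Unique-resp-⊆ []         []       = []
Unique-resp-⊆ (_ ∷ʳ s)   (_ ∷ u)  = Unique-resp-⊆ s u
Unique-resp-⊆ (refl ∷ s) (x ∷ u)  = All-resp-⊆ s x ∷ Unique-resp-⊆ s u

unique-length : ∀ {k} {xs : List (Fin k)} → Unique xs → length xs ≤ k
unique-length u = Fin.injective⇒≤ (unique-lookup u)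

module Walks (G : Graph) where
  open Graph G
  open Colouring

  reverseʷ : ∀ {u v} → Walk G u v → Walk G v u
  reverseʷ []      = []
  reverseʷ (e ∷ w) = _++ʷ_ G (reverseʷ w) (~-sym e ∷ [])

  length-++ʷ : ∀ {u v x} (w : Walk G u v) (w′ : Walk G v x) →
               walkLength (_++ʷ_ G w w′) ≡ walkLength w + walkLength w′
  length-++ʷ []      w′ = refl
  length-++ʷ (_ ∷ w) w′ = cong suc (length-++ʷ w w′)

  length-reverseʷ : ∀ {u v} (w : Walk G u v) → walkLength (reverseʷ w) ≡ walkLength w
  length-reverseʷ []      = refl
  length-reverseʷ (e ∷ w) = trans (length-++ʷ (reverseʷ w) _)
    (trans (cong (_+ 1) (length-reverseʷ w)) (ℕ.+-comm _ 1))

  module _ {k} (c : Colouring G k) where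

    colours-++ʷ : ∀ {u v x} (w : Walk G u v) (w′ : Walk G v x) →
                  colours c (_++ʷ_ G w w′) ≡ colours c w ++ colours c w′
    colours-++ʷ []      w′ = refl
    colours-++ʷ (e ∷ w) w′ = cong (colour c e ∷_) (colours-++ʷ w w′)

    colours-reverseʷ : ∀ {u v} (w : Walk G u v) →
                       colours c (reverseʷ w) ≡ reverse (colours c w)
    colours-reverseʷ []      = refl
    colours-reverseʷ (e ∷ w) = trans (colours-++ʷ (reverseʷ w) _)
      (trans (cong₂ (λ cs x → cs ++ x ∷ []) (colours-reverseʷ w) (colour-sym c (~-sym e) e))
             (sym (List.unfold-reverse (colour c e) (colours c w))))

    length-colours : ∀ {u v} (w : Walk G u v) → length (colours c w) ≡ walkLength w
    length-colours []      = refl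
    length-colours (_ ∷ w) = cong suc (length-colours w)

    rainbow-length : ∀ {u v} (w : Walk G u v) → IsRainbow c w → walkLength w ≤ k
    rainbow-length w u = subst (_≤ k) (length-colours w) (unique-length u)

    colours-suffix : ∀ {u v x} (w : Walk G u v) (p : IsPath w) (i : x ∈ vertices w) →
                     colours c (proj₁ (suffix G w p i)) ⊆ colours c w
    colours-suffix []      _       (here refl) = []
    colours-suffix (_ ∷ _) _       (here refl) = ⊆-refl
    colours-suffix (_ ∷ w) (_ ∷ p) (there i)   = _ ∷ʳ colours-suffix w p i

    -- Loop erasure drops edges and keeps the order of the rest. Repetition-free colour lists are
    -- closed under sublists, so rainbow connectivity can be tested on walks instead of paths.
    colours-toPath : ∀ {u v} (w : Walk G u v) →
                     colours c (proj₁ (toPath G w)) ⊆ colours c w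
    colours-toPath []          = []
    colours-toPath {u} (e ∷ w) with toPath G w | colours-toPath w
    ... | w′ , p | s with DecMembership._∈?_ _≟_ u (vertices w′)
    ...   | yes i = _ ∷ʳ ⊆-trans (colours-suffix w′ p i) s
    ...   | no _  = refl ∷ s

    RainbowWalk : V → V → Set
    RainbowWalk u v = Σ[ w ∈ Walk G u v ] IsRainbow c w

    rainbowColouring : (∀ u v → RainbowWalk u v) → IsRainbowColouring G c
    rainbowColouring rb u v with rb u v
    ... | w , r = toPath G w , Unique-resp-⊆ (colours-toPath w) r

  length-toPath : ∀ {u v} (w : Walk G u v) → walkLength (proj₁ (toPath G w)) ≤ walkLength w
  length-toPath w = subst₂ _≤_ (length-colours c (proj₁ (toPath G w))) (length-colours c w)
                      (length-mono-≤ (colours-toPath c w))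
    where
    -- Any colouring would serve: only the lengths of the colour lists are compared, and these are
    -- the walk lengths.
    c = injective-colouring G

  distance-≤ : ∀ {u v d} → IsDistance G u v d → (w : Walk G u v) → d ≤ walkLength w
  distance-≤ (_ , least) w = ℕ.≤-trans (least _ (toPath G w , refl)) (length-toPath w)

  connected-via : ∀ z → (∀ v → Walk G v z) → Connected G
  connected-via z w u v = toPath G (_++ʷ_ G (w u) (reverseʷ (w v)))

  -- A vertex of eccentricity `r` has another at distance `r`; a rainbow path between them has at
  -- least `r` edges, all of different colours.
  radius≤rc : ∀ {r k} → IsRadius G r → IsRainbowConnectionNumber G k → r ≤ k
  radius≤rc ((v , (u , dist) , _) , _) ((c , rb) , _) with rb v u
  ... | (w , _) , rainbow = ℕ.≤-trans (distance-≤ dist w) (rainbow-length c w rainbow)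

  distance≤ecc : Connected G → ∀ {v e} → IsEccentricity G v e →
                 ∀ u → Σ[ w ∈ Walk G v u ] walkLength w ≤ e
  distance≤ecc conn {v} (_ , greatest) u with distance-exists G (conn v u)
  ... | d , dist@(((w , _) , refl) , _) = w , greatest d (u , dist)

  radius-≤ : Connected G → ∀ {r} → IsRadius G r → ∀ v n →
             (∀ u → Σ[ w ∈ Walk G v u ] walkLength w ≤ n) → r ≤ n
  radius-≤ conn (_ , least) v n near with eccentricity-exists G conn v
  ... | e , ecc@((u , dist) , _) = ℕ.≤-trans (least e (v , ecc))
          (ℕ.≤-trans (distance-≤ dist (proj₁ (near u))) (proj₂ (near u)))

  radius-positive : NonTrivial G → Connected G → ∀ {r} → IsRadius G r → 1 ≤ r
  radius-positive nt conn {suc _} _ = s≤s z≤n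
  radius-positive nt conn {zero} ((v , ecc) , _) with other G nt v
  ... | u , v≢u with distance≤ecc conn ecc u
  ...   | [] , _ = contradiction refl v≢u


module _ (G H : Graph) where

  -- Steps inside a copy of `H` do not move the `G`-coordinate and are dropped.
  project : ∀ {u v} (w : Walk (G ∘ H) u v) →
            Σ[ w′ ∈ Walk G (proj₁ u) (proj₁ v) ] walkLength w′ ≤ walkLength w
  project []                 = [] , z≤n
  project (inj₁ e ∷ w)          with project w
  ... | w′ , le = e ∷ w′ , s≤s le
  project (inj₂ (refl , _) ∷ w) with project w
  ... | w′ , le = w′ , ℕ.m≤n⇒m≤1+n le

-- Upper bound for radius at least two: the layered colouring.

opposite-≢ : (e : Fin 2) → e ≢ opposite e
opposite-≢ zero       ()
opposite-≢ (suc zero) ()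

-- Side 1 consists of the vertices with H-coordinate b.  An edge between layers n and n+1
-- with n ≥ 1 gets the side of its end in layer n and index n; an edge between
-- layers 0 and 1 gets the side of its end in layer 1, and index 0 or 1 according
-- to whether its end in layer 0 is the hub (g₀ , b) or not.
module Layered (G H : Graph) (nontrivial : NonTrivial G) (conn : Connected G) (g₀ : Graph.V G)
               (a b : Graph.V H) (a≢b : a ≢ b)
               (m : ℕ) (near : ∀ g → Σ[ w ∈ Walk G g₀ g ] walkLength w ≤ suc (suc m)) where

  private
    module G = Graph G
    module H = Graph H

  P : Graph
  P = G ∘ H

  r : ℕ
  r = suc (suc m)

  open Graph P using (V)
  open Walks P

  hub : V
  hub = g₀ , b

  level : G.V → ℕ
  level g = proj₁ (distance-exists G (conn g g₀))

  level-≤ : ∀ {g} (w : Walk G g g₀) → level g ≤ walkLength w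
  level-≤ {g} = Walks.distance-≤ G (proj₂ (distance-exists G (conn g g₀)))

  level≤r : ∀ g → level g ≤ r
  level≤r g = let w , le = near g in
    ℕ.≤-trans (level-≤ (Walks.reverseʷ G w)) (subst (_≤ r) (sym (Walks.length-reverseʷ G w)) le)

  shortest : ∀ g → Σ[ w ∈ Walk G g g₀ ] walkLength w ≡ level g
  shortest g with distance-exists G (conn g g₀)
  ... | _ , ((w , _) , eq) , _ = w , eq

  level-zero : ∀ {g} → level g ≡ 0 → g ≡ g₀
  level-zero {g} eq with shortest g
  ... | []    , _  = refl
  ... | _ ∷ _ , eq′ = contradiction (trans eq′ eq) λ ()

  level-g₀ : level g₀ ≡ 0
  level-g₀ = ℕ.n≤0⇒n≡0 (level-≤ [])

  parent : ∀ {g n} → level g ≡ suc n → Σ[ p ∈ G.V ] (g G.~ p × level p ≡ n)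
  parent {g} {n} eq with shortest g
  ... | []    , eq′ = contradiction (trans eq′ eq) λ ()
  ... | _∷_ {w = p} e w , eq′ with shortest p
  ...   | w′ , eq″ = p , e , ℕ.≤-antisym
            (subst (level p ≤_) (ℕ.suc-injective (trans eq′ eq)) (level-≤ w))
            (s≤s⁻¹ (subst₂ _≤_ eq (cong suc eq″) (level-≤ (e ∷ w′))))

  side : H.V → Fin 2
  side h = if does (h H.≟ b) then suc zero else zero

  side-b : side b ≡ suc zero
  side-b = cong (λ t → if t then suc zero else zero) (dec-true (b H.≟ b) refl)

  side-≢b : ∀ {h} → h ≢ b → side h ≡ zero
  side-≢b {h} h≢b = cong (λ t → if t then suc zero else zero) (dec-false (h H.≟ b) h≢b)

  rep : Fin 2 → H.V
  rep zero    = a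
  rep (suc _) = b

  side-rep : ∀ e → side (rep e) ≡ e
  side-rep zero       = side-≢b a≢b
  side-rep (suc zero) = side-b

  class : Fin (2 * r) → Fin 2
  class x = proj₁ (remQuot {2} r x)

  index : Fin (2 * r) → ℕ
  index x = toℕ (proj₂ (remQuot {2} r x))

  abstract
    -- Reduction modulo `r` only makes `shade` total: every index used below is smaller than `r`.
    shade : Fin 2 → ℕ → Fin (2 * r)
    shade e k = combine e (k mod r)

    class-shade : ∀ e k → class (shade e k) ≡ e
    class-shade e k = cong proj₁ (Fin.remQuot-combine {2} e (k mod r))

    index-shade : ∀ e {k} → k < r → index (shade e k) ≡ k
    index-shade e {k} k<r = trans (cong (λ x → toℕ (proj₂ x)) (Fin.remQuot-combine {2} e (k mod r)))
      (trans (Fin.toℕ-fromℕ< _) (m<n⇒m%n≡m k<r))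

  shade-≢-class : ∀ {e e′ k l} → e ≢ e′ → shade e k ≢ shade e′ l
  shade-≢-class {e} {e′} {k} {l} e≢e′ eq =
    e≢e′ (trans (sym (class-shade e k)) (trans (cong class eq) (class-shade e′ l)))

  shade-0≢1 : ∀ {e e′} → shade e 0 ≢ shade e′ 1
  shade-0≢1 {e} {e′} eq = contradiction
    (trans (sym (index-shade e {0} (s≤s z≤n)))
      (trans (cong index eq) (index-shade e′ {1} (s≤s (s≤s z≤n))))) λ ()

  -- `x` belongs to the end nearer to `g₀`. Since `b` has side 1, `opposite` gives index 0 at the
  -- hub and index 1 at the other vertices of layer 0.
  tint : ℕ → H.V → H.V → Fin (2 * r)
  tint zero    x y = shade (side y) (toℕ (opposite (side x)))
  tint (suc n) x y = shade (side x) (suc n)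

  paint : V → V → Fin (2 * r)
  paint (g , x) (g′ , y) with ℕ.<-cmp (level g) (level g′)
  ... | tri< _ _ _ = tint (level g) x y
  -- An arbitrary default: no walk constructed below uses an edge inside a layer.
  ... | tri≈ _ _ _ = shade zero 0
  ... | tri> _ _ _ = tint (level g′) y x

  paint-sym : ∀ u v → paint u v ≡ paint v u
  paint-sym (g , x) (g′ , y) with ℕ.<-cmp (level g) (level g′) | ℕ.<-cmp (level g′) (level g)
  ... | tri< _ _ _  | tri> _ _ _  = refl
  ... | tri≈ _ _ _  | tri≈ _ _ _  = refl
  ... | tri> _ _ _  | tri< _ _ _  = refl
  ... | tri< l _ _  | tri< l′ _ _ = contradiction l′ (ℕ.<-asym l)
  ... | tri< l _ _  | tri≈ _ e _  = contradiction (sym e) (ℕ.<⇒≢ l)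
  ... | tri≈ _ e _  | tri< l _ _  = contradiction (sym e) (ℕ.<⇒≢ l)
  ... | tri≈ _ e _  | tri> _ _ l  = contradiction e (ℕ.<⇒≢ l)
  ... | tri> _ _ l  | tri≈ _ e _  = contradiction e (ℕ.<⇒≢ l)
  ... | tri> _ _ l  | tri> _ _ l′ = contradiction l′ (ℕ.<-asym l)

  paint-up : ∀ {g g′ x y n} → level g ≡ suc n → level g′ ≡ n → paint (g , x) (g′ , y) ≡ tint n y x
  paint-up {g} {g′} eq eq′ with ℕ.<-cmp (level g) (level g′)
  ... | tri< l _ _ = contradiction (ℕ.≤-reflexive (trans (cong suc eq′) (sym eq))) (ℕ.<-asym l)
  ... | tri≈ _ e _ = contradiction (trans (sym eq) (trans e eq′)) λ eq → ℕ.1+n≢n eq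
  ... | tri> _ _ _ = cong (λ n → tint n _ _) eq′

  c : Colouring P (2 * r)
  c = record { colour = λ {u} {v} _ → paint u v ; colour-sym = λ {u} {v} _ _ → paint-sym u v }

  Climb : Fin 2 → V → Set
  Climb e u = Σ[ w ∈ Walk P u hub ] (IsRainbow c w × All (λ x → class x ≡ e) (colours c w))

  -- Different classes make the two colour lists disjoint, and reversal merely permutes the second
  -- one.
  meet : ∀ {e e′ u v} → e ≢ e′ → Climb e u → Climb e′ v → RainbowWalk c u v
  meet e≢e′ (w , rw , cw) (w′ , rw′ , cw′) =
    _++ʷ_ P w (reverseʷ w′) ,
    subst Unique (sym (colours-++ʷ c w (reverseʷ w′))) (Unique.++⁺ rw reversed disjoint)
    where
    reverse-↭ = ↭-sym (↭-reverse (colours c w′))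

    reversed : Unique (colours c (reverseʷ w′))
    reversed = subst Unique (sym (colours-reverseʷ c w′))
                 (Unique-resp-↭ (setoid _) (↭⇒↭ₛ reverse-↭) rw′)

    disjoint : ∀ {x} → ¬ (x ∈ colours c w × x ∈ colours c (reverseʷ w′))
    disjoint {x} (i , j) = e≢e′ (trans (sym (All.lookup cw i)) (All.lookup cw′
      (∈-resp-↭ (↭-reverse (colours c w′)) (subst (x ∈_) (colours-reverseʷ c w′) j))))

  hub-index : toℕ (opposite (side b)) ≡ 0
  hub-index = cong (λ e → toℕ (opposite e)) side-b

  child : Σ[ g ∈ G.V ] (g₀ G.~ g × level g ≡ 1)
  child with neighbour G nontrivial conn g₀
  ... | g , e = g , e , ℕ.≤-antisym (level-≤ (G.~-sym e ∷ []))
                  (ℕ.n≢0⇒n>0 λ eq → G.~-irrefl (subst (g₀ G.~_) (level-zero eq) e))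

  level-one : ∀ {g} → level g ≡ 1 → g G.~ g₀
  level-one eq with parent eq
  ... | p , e , eq′ = subst (_ G.~_) (level-zero eq′) e

  colour-root : ∀ {g x y} → level g ≡ 1 → paint (g , x) (g₀ , y) ≡ shade (side x) (toℕ (opposite (side y)))
  colour-root eq = paint-up eq level-g₀

  colour-hub : ∀ {g x} → level g ≡ 1 → paint (g , x) hub ≡ shade (side x) 0
  colour-hub eq = trans (colour-root eq) (cong (shade _) hub-index)

  -- In layer 1 the side is forced; from any other layer the climb passes through rep e.
  climb-layer : ∀ n {g h} e → level g ≡ suc n → (n ≡ 0 → side h ≡ e) →
    Σ[ w ∈ Walk P (g , h) hub ]
      (IsRainbow c w × All (λ x → class x ≡ e × index x ≤ n) (colours c w))
  climb-layer zero {g} {h} e eq own = inj₁ (level-one eq) ∷ [] , [] ∷ [] ,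
    subst (λ x → class x ≡ e × index x ≤ 0) (sym (trans (colour-hub eq) (cong (λ e → shade e 0) (own refl))))
      (class-shade e 0 , ℕ.≤-reflexive (index-shade e (s≤s z≤n))) ∷ []
  climb-layer (suc n) {g} {h} e eq _ with parent eq
  ... | p , edge , eq′ with climb-layer n {p} {rep e} e eq′ (λ _ → side-rep e)
  ...   | w , rw , cw = inj₁ edge ∷ w ,
          -- The first colour is new: its index is `suc n`, while the rest of the climb stays at
          -- indices up to `n`.
          All.map (λ { (_ , le) same → ℕ.1+n≰n (subst (_≤ n) (trans (sym (cong index same)) idx) le) }) cw ∷ rw ,
          (trans (cong class first) (class-shade e (suc n)) , ℕ.≤-reflexive idx)
            ∷ All.map (λ { (cl , le) → cl , ℕ.m≤n⇒m≤1+n le }) cw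
    where
    first : paint (g , h) (p , rep e) ≡ shade e (suc n)
    first = trans (paint-up eq eq′) (cong (λ e → shade e (suc n)) (side-rep e))

    idx : index (paint (g , h) (p , rep e)) ≡ suc n
    idx = trans (cong index first) (index-shade e (subst (_≤ r) eq (level≤r g)))

  -- Off the hub, the climb visits layer 1 at `rep e` and returns to the hub. Both edges take side
  -- `e` from that vertex, and their indices 1 and 0 tell them apart.
  climb-root : ∀ h e → Climb e (g₀ , h)
  climb-root h e with h H.≟ b
  ... | yes refl = [] , [] , []
  ... | no h≢b with child
  ...   | g , edge , eq = inj₁ edge ∷ inj₁ (G.~-sym edge) ∷ [] ,
          ((λ same → shade-0≢1 (trans (sym up) (trans (sym same) down))) ∷ []) ∷ [] ∷ [] ,
          trans (cong class down) (class-shade e 1) ∷ trans (cong class up) (class-shade e 0) ∷ []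
    where
    down : paint (g₀ , h) (g , rep e) ≡ shade e 1
    down = trans (paint-sym (g₀ , h) (g , rep e)) (trans (colour-root eq)
             (cong₂ shade (side-rep e) (cong (λ e → toℕ (opposite e)) (side-≢b h≢b))))

    up : paint (g , rep e) hub ≡ shade e 0
    up = trans (colour-hub eq) (cong (λ e → shade e 0) (side-rep e))

  climb : ∀ u → (∀ e → Climb e u) ⊎ (level (proj₁ u) ≡ 1 × Climb (side (proj₂ u)) u)
  climb (g , h) = go (level g) refl
    where
    forget : ∀ {n e} → Σ[ w ∈ Walk P (g , h) hub ]
               (IsRainbow c w × All (λ x → class x ≡ e × index x ≤ n) (colours c w)) → Climb e (g , h)
    forget (w , rw , cw) = w , rw , All.map proj₁ cw

    go : ∀ n → level g ≡ n → (∀ e → Climb e (g , h)) ⊎ (level g ≡ 1 × Climb (side h) (g , h))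
    go 0             eq = inj₁ λ e → subst (λ g → Climb e (g , h)) (sym (level-zero eq)) (climb-root h e)
    go 1             eq = inj₂ (eq , forget (climb-layer 0 (side h) eq λ _ → refl))
    go (suc (suc n)) eq = inj₁ λ e → forget (climb-layer (suc n) e eq λ ())

  -- The walk visits the hub, a layer 1 vertex of the opposite side, and `(g₀ , a)`. The two edges
  -- at the hub have index 0, the two at `(g₀ , a)` index 1, and within each pair the sides differ.
  detour : ∀ {g h g′ h′} → level g ≡ 1 → level g′ ≡ 1 → side h ≡ side h′ →
           RainbowWalk c (g , h) (g′ , h′)
  detour {g} {h} {g′} {h′} eq eq′ same with child
  ... | k , edge , eqk =
    inj₁ (level-one eq) ∷ inj₁ edge ∷ inj₁ (G.~-sym edge) ∷ inj₁ (G.~-sym (level-one eq′)) ∷ [] ,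
    subst Unique (sym list) distinct
    where
    e = side h
    ē = opposite e

    distinct : Unique (shade e 0 ∷ shade ē 0 ∷ shade ē 1 ∷ shade e 1 ∷ [])
    distinct = (shade-≢-class (opposite-≢ e) ∷ shade-≢-class (opposite-≢ e) ∷ shade-0≢1 ∷ [])
             ∷ (shade-0≢1 ∷ shade-0≢1 ∷ [])
             ∷ (shade-≢-class (≢-sym (opposite-≢ e)) ∷ [])
             ∷ [] ∷ []

    a-index : toℕ (opposite (side a)) ≡ 1
    a-index = cong (λ e → toℕ (opposite e)) (side-rep zero)

    list : paint (g , h) hub ∷ paint hub (k , rep ē) ∷ paint (k , rep ē) (g₀ , a)
             ∷ paint (g₀ , a) (g′ , h′) ∷ []
           ≡ shade e 0 ∷ shade ē 0 ∷ shade ē 1 ∷ shade e 1 ∷ []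
    list = cong₂ _∷_ (colour-hub eq)
      (cong₂ _∷_ (trans (paint-sym hub (k , rep ē)) (trans (colour-hub eqk) (cong (λ e → shade e 0) (side-rep ē))))
      (cong₂ _∷_ (trans (colour-root eqk) (cong₂ shade (side-rep ē) a-index))
      (cong (_∷ []) (trans (paint-sym (g₀ , a) (g′ , h′))
        (trans (colour-root eq′) (cong₂ shade (sym same) a-index))))))

  rainbow : IsRainbowColouring P c
  rainbow = rainbowColouring c connect
    where
    connect : ∀ u v → RainbowWalk c u v
    connect u v with climb u | climb v
    ... | inj₁ f        | inj₁ f′        = meet (λ ()) (f zero) (f′ (suc zero))
    -- The end that is free to choose takes the side opposite to the forced one.
    ... | inj₁ f        | inj₂ (_ , w)   = meet (≢-sym (opposite-≢ _)) (f _) w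
    ... | inj₂ (_ , w)  | inj₁ f         = meet (opposite-≢ _) w (f _)
    ... | inj₂ (eq , w) | inj₂ (eq′ , w′) with side (proj₂ u) Fin.≟ side (proj₂ v)
    ...   | yes same = detour eq eq′ same
    ...   | no differ = meet differ w w′

-- Upper bound for radius one: three colours around a universal vertex.

-- Besides the apex there are X = {g₀} × (H − h₀) and Y = (G − g₀) × H, which are completely
-- joined; apex–X, apex–Y and X–Y edges get one colour each.
module Coned (G H : Graph) (nG : NonTrivial G) (nH : NonTrivial H) (g₀ : Graph.V G) (h₀ : Graph.V H)
             (cone : ∀ u → u ≢ (g₀ , h₀) → Graph._~_ (G ∘ H) (g₀ , h₀) u) where

  private
    module G = Graph G
    module H = Graph H

  P : Graph
  P = G ∘ H

  open Graph P using (V)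
  open Walks P

  apex : V
  apex = g₀ , h₀

  data View : V → Set where
    at-apex : View apex
    in-X    : ∀ {h} → h ≢ h₀ → View (g₀ , h)
    in-Y    : ∀ {g h} → g ≢ g₀ → View (g , h)

  view : ∀ u → View u
  view (g , h) with g G.≟ g₀
  ... | no g≢g₀ = in-Y g≢g₀
  ... | yes refl with h H.≟ h₀
  ...   | yes refl = at-apex
  ...   | no h≢h₀  = in-X h≢h₀

  kind : V → Fin 3
  kind (g , h) = if does (g G.≟ g₀) then (if does (h H.≟ h₀) then zero else suc zero)
                                    else suc (suc zero)

  kind-apex : kind apex ≡ zero
  kind-apex rewrite dec-true (g₀ G.≟ g₀) refl | dec-true (h₀ H.≟ h₀) refl = refl

  kind-X : ∀ {h} → h ≢ h₀ → kind (g₀ , h) ≡ suc zero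
  kind-X {h} h≢ rewrite dec-true (g₀ G.≟ g₀) refl | dec-false (h H.≟ h₀) h≢ = refl

  kind-Y : ∀ {g h} → g ≢ g₀ → kind (g , h) ≡ suc (suc zero)
  kind-Y {g} g≢ rewrite dec-false (g G.≟ g₀) g≢ = refl

  mix : Fin 3 → Fin 3 → Fin 3
  mix zero          (suc (suc _)) = suc zero
  mix (suc (suc _)) zero          = suc zero
  mix (suc zero)    (suc (suc _)) = suc (suc zero)
  mix (suc (suc _)) (suc zero)    = suc (suc zero)
  -- This covers apex-X edges, and also edges within one kind, which no walk below uses.
  mix _             _             = zero

  mix-sym : ∀ i j → mix i j ≡ mix j i
  mix-sym zero             zero             = refl
  mix-sym zero             (suc zero)       = refl
  mix-sym zero             (suc (suc zero)) = refl
  mix-sym (suc zero)       zero             = refl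
  mix-sym (suc zero)       (suc zero)       = refl
  mix-sym (suc zero)       (suc (suc zero)) = refl
  mix-sym (suc (suc zero)) zero             = refl
  mix-sym (suc (suc zero)) (suc zero)       = refl
  mix-sym (suc (suc zero)) (suc (suc zero)) = refl

  c : Colouring P 3
  c = record { colour     = λ {u} {v} _ → mix (kind u) (kind v)
             ; colour-sym = λ {u} {v} _ _ → mix-sym (kind u) (kind v) }

  -- An edge from the apex that changes the first coordinate must come from `G`, so universality
  -- passes to `g₀`; `h₀~` is the counterpart within the copy of `H` over `g₀`.
  g₀~ : ∀ {g} → g ≢ g₀ → g₀ G.~ g
  g₀~ {g} g≢ with cone (g , h₀) (λ eq → g≢ (cong proj₁ eq))
  ... | inj₁ e        = e
  ... | inj₂ (eq , _) = contradiction (sym eq) g≢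

  h₀~ : ∀ {h} → h ≢ h₀ → h₀ H.~ h
  h₀~ {h} h≢ with cone (g₀ , h) (λ eq → h≢ (cong proj₂ eq))
  ... | inj₁ e       = contradiction e G.~-irrefl
  ... | inj₂ (_ , e) = e

  -- Replaces the kinds, which do not reduce on variable vertices, by numerals on which distinctness
  -- is decided by computation.
  three-steps : ∀ {u y v i j k} → kind u ≡ i → kind y ≡ j → kind v ≡ k →
    Unique (mix i j ∷ mix j zero ∷ mix zero k ∷ []) →
    Unique (mix (kind u) (kind y) ∷ mix (kind y) (kind apex) ∷ mix (kind apex) (kind v) ∷ [])
  three-steps refl refl refl unique rewrite kind-apex = unique

  rainbow : IsRainbowColouring P c
  rainbow = rainbowColouring c connect
    where
    x₀ = proj₁ (other H nH h₀)
    x₀≢ = ≢-sym (proj₂ (other H nH h₀))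
    y₀ = proj₁ (other G nG g₀)
    y₀≢ = ≢-sym (proj₂ (other G nG g₀))

    connect : ∀ u v → RainbowWalk c u v
    connect u v with view u | view v
    ... | at-apex | at-apex = [] , []
    ... | at-apex | in-X h≢ = inj₂ (refl , h₀~ h≢) ∷ [] , [] ∷ []
    ... | at-apex | in-Y g≢ = inj₁ (g₀~ g≢) ∷ [] , [] ∷ []
    ... | in-X h≢ | at-apex = inj₂ (refl , H.~-sym (h₀~ h≢)) ∷ [] , [] ∷ []
    ... | in-Y g≢ | at-apex = inj₁ (G.~-sym (g₀~ g≢)) ∷ [] , [] ∷ []
    ... | in-X h≢ | in-Y g≢ = inj₁ (g₀~ g≢) ∷ [] , [] ∷ []
    ... | in-Y g≢ | in-X h≢ = inj₁ (G.~-sym (g₀~ g≢)) ∷ [] , [] ∷ []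
    -- Two vertices of one kind, possibly equal, are joined through the other kind and then the
    -- apex, using each of the three colours once.
    ... | in-X h≢ | in-X h≢′ =
      _∷_ {w = y₀ , h₀} (inj₁ (g₀~ y₀≢)) (inj₁ (G.~-sym (g₀~ y₀≢)) ∷ inj₂ (refl , h₀~ h≢′) ∷ []) ,
      three-steps (kind-X h≢) (kind-Y y₀≢) (kind-X h≢′)
        (((λ ()) ∷ (λ ()) ∷ []) ∷ ((λ ()) ∷ []) ∷ [] ∷ [])
    ... | in-Y g≢ | in-Y g≢′ =
      _∷_ {w = g₀ , x₀} (inj₁ (G.~-sym (g₀~ g≢))) (inj₂ (refl , H.~-sym (h₀~ x₀≢)) ∷ inj₁ (g₀~ g≢′) ∷ []) ,
      three-steps (kind-Y g≢) (kind-X x₀≢) (kind-Y g≢′)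
        (((λ ()) ∷ (λ ()) ∷ []) ∷ ((λ ()) ∷ []) ∷ [] ∷ [])

-- From a centre of the product to the two upper bounds.

module Bounds (G H : Graph) (nG : NonTrivial G) (nH : NonTrivial H) (conn : Connected G) where

  open Walks (G ∘ H)

  abstract
    connected : Connected (G ∘ H)
    connected = ∘-connected G H nG conn

  rc≤2r : ∀ {r k} → IsRadius (G ∘ H) r → IsRainbowConnectionNumber (G ∘ H) k → 2 ≤ r → k ≤ 2 * r
  rc≤2r {suc (suc m)} (((g₀ , h₀) , ecc) , _) (_ , least) _ = least _ (L.c , L.rainbow)
    where
    b = other H nH h₀

    near : ∀ g → Σ[ w ∈ Walk G g₀ g ] walkLength w ≤ suc (suc m)
    near g with distance≤ecc connected ecc (g , h₀)
    ... | w , le with project G H w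
    ...   | w′ , le′ = w′ , ℕ.≤-trans le′ le

    -- Layers depend only on the `G`-coordinate of the centre, so the hub may lie over a different
    -- vertex of `H`; `h₀` then represents side 0.
    module L = Layered G H nG conn g₀ h₀ (proj₁ b) (proj₂ b) m near
  rc≤2r {suc zero} _ _ (s≤s ())

  rc≤3 : ∀ {k} → IsRadius (G ∘ H) 1 → IsRainbowConnectionNumber (G ∘ H) k → k ≤ 3
  rc≤3 (((g₀ , h₀) , ecc) , _) (_ , least) = least _ (C.c , C.rainbow)
    where
    cone : ∀ u → u ≢ (g₀ , h₀) → Graph._~_ (G ∘ H) (g₀ , h₀) u
    cone u u≢ with distance≤ecc connected ecc u
    ... | []         , _       = contradiction refl u≢
    ... | e ∷ []     , _       = e
    ... | _ ∷ _ ∷ _  , s≤s ()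

    module C = Coned G H nG nH g₀ h₀ cone

-- Examples attaining the bounds.

PathGraph : ℕ → Graph
PathGraph n = record
  { V        = Fin n
  ; order    = n
  ; finite   = ↔-refl
  ; _~_      = λ i j → ∣ toℕ i - toℕ j ∣ ≡ 1
  ; _~?_     = λ i j → ∣ toℕ i - toℕ j ∣ ℕ.≟ 1
  ; ~-sym    = λ {i} {j} → trans (ℕ.∣-∣-comm (toℕ j) (toℕ i))
  ; ~-irrefl = λ {i} eq → contradiction (trans (sym (ℕ.∣n-n∣≡0 (toℕ i))) eq) λ ()
  }

path-lipschitz : ∀ {n} {i j : Fin n} (w : Walk (PathGraph n) i j) →
                 ∣ toℕ i - toℕ j ∣ ≤ walkLength w
path-lipschitz {i = i} []                    = ℕ.≤-reflexive (ℕ.∣n-n∣≡0 (toℕ i))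
path-lipschitz {i = i} {j} (_∷_ {w = k} e w) =
  ℕ.≤-trans (ℕ.∣-∣-triangle (toℕ i) (toℕ k) (toℕ j))
            (ℕ.+-mono-≤ (ℕ.≤-reflexive e) (path-lipschitz w))

-- The complete bipartite graph `K₁,ₙ` with centre `zero`; `Star 1` is `K₂`.
Star : ℕ → Graph
Star n = record
  { V        = Fin (suc n)
  ; order    = suc n
  ; finite   = ↔-refl
  ; _~_      = adj
  ; _~?_     = adj?
  ; ~-sym    = λ {i} {j} → adj-sym i j
  ; ~-irrefl = λ {i} → adj-irrefl i
  }
  where
  adj : Fin (suc n) → Fin (suc n) → Set
  adj zero    (suc _) = ⊤
  adj (suc _) zero    = ⊤
  adj _       _       = ⊥

  adj? : ∀ i j → Dec (adj i j)
  adj? zero    zero    = no λ ()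
  adj? zero    (suc _) = yes tt
  adj? (suc _) zero    = yes tt
  adj? (suc _) (suc _) = no λ ()

  adj-sym : ∀ i j → adj i j → adj j i
  adj-sym zero    (suc _) _ = tt
  adj-sym (suc _) zero    _ = tt

  adj-irrefl : ∀ i → ¬ adj i i
  adj-irrefl zero    ()
  adj-irrefl (suc _) ()

Star-connected : ∀ n → Connected (Star n)
Star-connected n = Walks.connected-via (Star n) zero λ { zero → [] ; (suc _) → tt ∷ [] }

two≤ : ∀ {n} → 2 ≤ suc (suc n)
two≤ = s≤s (s≤s z≤n)

module Tight₁ where

  G H : Graph
  G = PathGraph 5
  H = Star 1

  mid : Fin 5
  mid = suc (suc zero)

  G-connected : Connected G
  G-connected = Walks.connected-via G mid λ where
    zero                         → _∷_ {w = suc zero} refl (refl ∷ [])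
    (suc zero)                   → refl ∷ []
    (suc (suc zero))             → []
    (suc (suc (suc zero)))       → refl ∷ []
    (suc (suc (suc (suc zero)))) → _∷_ {w = suc (suc (suc zero))} refl (refl ∷ [])

  open Walks (G ∘ H)
  open Bounds G H two≤ two≤ G-connected

  near : ∀ u → Σ[ w ∈ Walk (G ∘ H) (mid , zero) u ] walkLength w ≤ 2
  near (zero                         , _) = _∷_ {w = suc zero , zero} (inj₁ refl) (inj₁ refl ∷ []) , two≤
  near (suc zero                     , _) = inj₁ refl ∷ [] , s≤s z≤n
  -- Both vertices over `mid` are reached by stepping out to a neighbouring copy and back.
  near (suc (suc zero)               , _) = _∷_ {w = suc zero , zero} (inj₁ refl) (inj₁ refl ∷ []) , two≤
  near (suc (suc (suc zero))         , _) = inj₁ refl ∷ [] , s≤s z≤n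
  near (suc (suc (suc (suc zero)))   , _) =
    _∷_ {w = suc (suc (suc zero)) , zero} (inj₁ refl) (inj₁ refl ∷ []) , two≤

  last : Fin 5
  last = suc (suc (suc (suc zero)))

  span : ∀ {i j x y} (w : Walk (G ∘ H) (i , x) (j , y)) → ∣ toℕ i - toℕ j ∣ ≤ walkLength w
  span w with project G H w
  ... | w′ , le = ℕ.≤-trans (path-lipschitz w′) le

  r≤2 : ∀ {r} → IsRadius (G ∘ H) r → r ≤ 2
  r≤2 radius = radius-≤ connected radius (mid , zero) 2 near

  -- The ends of the path are four apart, so the distances from any centre to the copies of the two
  -- ends add up to at least four.
  2≤r : ∀ {r} → IsRadius (G ∘ H) r → 2 ≤ r
  2≤r {r} (((i , x) , ecc) , _)
    with distance≤ecc connected ecc (zero , x) | distance≤ecc connected ecc (last , x)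
  ... | w , le | w′ , le′ = ℕ.*-cancelˡ-≤ {2} {r} 2 (begin
    4                              ≤⟨ ℕ.∣-∣-triangle 0 (toℕ i) 4 ⟩
    ∣ 0 - toℕ i ∣ + ∣ toℕ i - 4 ∣  ≡⟨ cong (_+ ∣ toℕ i - 4 ∣) (ℕ.∣-∣-comm 0 (toℕ i)) ⟩
    ∣ toℕ i - 0 ∣ + ∣ toℕ i - 4 ∣  ≤⟨ ℕ.+-mono-≤ (ℕ.≤-trans (span w) le) (ℕ.≤-trans (span w′) le′) ⟩
    r + r                          ≡⟨ cong (r +_) (ℕ.+-identityʳ r) ⟨
    2 * r                          ∎)
    where open ℕ.≤-Reasoning

  4≤rc : ∀ {k} → IsRainbowConnectionNumber (G ∘ H) k → 4 ≤ k
  4≤rc ((c , rb) , _) with rb (zero , zero) (last , zero)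
  ... | (w , _) , rainbow = ℕ.≤-trans (span w) (rainbow-length c w rainbow)

  tight : ∃[ r ] ∃[ rc ] (NonTrivial G × NonTrivial H × Connected G ×
            IsRadius (G ∘ H) r × IsRainbowConnectionNumber (G ∘ H) rc × 2 ≤ r × rc ≡ 2 * r)
  tight = let r , radius = radius-exists (G ∘ H) (s≤s z≤n) connected
              k , number = rainbowConnectionNumber-exists (G ∘ H) connected
    in r , k , two≤ , two≤ , G-connected , radius , number , 2≤r radius ,
       ℕ.≤-antisym (rc≤2r radius number (2≤r radius))
                   (ℕ.≤-trans (ℕ.*-monoʳ-≤ 2 (r≤2 radius)) (4≤rc number))

module Tight₂ where

  G H : Graph
  G = Star 5
  H = Star 1

  open Walks (G ∘ H)
  open Bounds G H two≤ two≤ (Star-connected 5)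
  open Colouring

  leaf : Fin 5 → Graph.V (G ∘ H)
  leaf i = suc i , zero

  near : ∀ u → Σ[ w ∈ Walk (G ∘ H) (zero , zero) u ] walkLength w ≤ 1
  near (zero  , zero)     = [] , z≤n
  near (zero  , suc zero) = inj₂ (refl , tt) ∷ [] , s≤s z≤n
  near (suc _ , _)        = inj₁ tt ∷ [] , s≤s z≤n

  radius-one : ∀ {r} → IsRadius (G ∘ H) r → r ≡ 1
  radius-one radius = ℕ.≤-antisym (radius-≤ connected radius (zero , zero) 1 near)
                                  (radius-positive two≤ connected radius)

  3≤rc : ∀ {k} → IsRainbowConnectionNumber (G ∘ H) k → 3 ≤ k
  3≤rc {k} ((c , rb) , _) = ℕ.≰⇒> few
    where
    seen : Fin 5 → Fin 2 → Fin k
    seen i h = colour c {leaf i} {zero , h} (inj₁ tt)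

    signature : Fin 5 → Fin (k * k)
    signature i = combine (seen i zero) (seen i (suc zero))

    few : ¬ (k ≤ 2)
    -- Two colours give at most four signatures, fewer than the five leaves.
    few k≤2 with Fin.pigeonhole (s≤s (ℕ.*-mono-≤ k≤2 k≤2)) signature
    ... | i , j , i<j , eq with rb (leaf i) (leaf j)
    ...   | (w , _) , rainbow = no-walk w rainbow (ℕ.≤-trans (rainbow-length c w rainbow) k≤2)
      where
      i≢j : i ≢ j
      i≢j refl = ℕ.<-irrefl refl i<j

      both = Fin.combine-injective (seen i zero) (seen i (suc zero)) (seen j zero) (seen j (suc zero)) eq

      same : ∀ h → seen i h ≡ seen j h
      same zero       = proj₁ both
      same (suc zero) = proj₂ both

      repeated : ∀ h → ¬ Unique (colour c {leaf i} {zero , h} (inj₁ tt)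
                                 ∷ colour c {zero , h} {leaf j} (inj₁ tt) ∷ [])
      repeated h ((new ∷ []) ∷ _) = new (trans (same h) (colour-sym c (inj₁ tt) (inj₁ tt)))

      no-walk : (w : Walk (G ∘ H) (leaf i) (leaf j)) → IsRainbow c w → ¬ (walkLength w ≤ 2)
      no-walk w rainbow le = by-ends w refl refl rainbow le
        where
        -- The ends are generalised to variables with equations so that the walk can be matched on.
        -- Only the vertices over the centre of the star can be the middle of a walk of length two.
        by-ends : ∀ {u v} (w : Walk (G ∘ H) u v) → u ≡ leaf i → v ≡ leaf j →
                  IsRainbow c w → ¬ (walkLength w ≤ 2)
        by-ends [] refl eq _ _ = i≢j (Fin.suc-injective (cong proj₁ eq))
        by-ends (inj₁ () ∷ []) refl refl _ _
        by-ends (inj₂ (eq , _) ∷ []) refl refl _ _ = i≢j (Fin.suc-injective eq)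
        by-ends (_∷_ {w = zero  , h} (inj₁ _) (inj₁ _ ∷ []))        refl refl r _ = repeated h r
        by-ends (_∷_ {w = zero  , h} (inj₁ _) (inj₂ (() , _) ∷ [])) refl refl _ _
        by-ends (_∷_ {w = suc _ , _} (inj₁ ()) _)                   refl refl _ _
        by-ends (inj₂ (refl , _) ∷ inj₁ () ∷ [])                    refl refl _ _
        by-ends (inj₂ (refl , _) ∷ inj₂ (eq , _) ∷ [])              refl refl _ _ = i≢j (Fin.suc-injective eq)
        by-ends (_ ∷ _ ∷ _ ∷ _) _ _ _ (s≤s (s≤s ()))

  tight : ∃[ r ] ∃[ rc ] (NonTrivial G × NonTrivial H × Connected G ×
            IsRadius (G ∘ H) r × IsRainbowConnectionNumber (G ∘ H) rc × r ≡ 1 × rc ≡ 3)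
  tight = let r , radius = radius-exists (G ∘ H) (s≤s z≤n) connected
              k , number = rainbowConnectionNumber-exists (G ∘ H) connected
    in r , k , two≤ , two≤ , Star-connected 5 , radius , number , radius-one radius ,
       ℕ.≤-antisym (rc≤3 (subst (IsRadius (G ∘ H)) (radius-one radius) radius) number) (3≤rc number)

theorem3 : (∀ (G′ H : Graph) → NonTrivial G′ → NonTrivial H → Connected G′ →
    ∀ (r rc : ℕ) → IsRadius (G′ ∘ H) r → IsRainbowConnectionNumber (G′ ∘ H) rc →
    (2 ≤ r → r ≤ rc × rc ≤ 2 * r) ×
    (r ≡ 1 → 1 ≤ rc × rc ≤ 3)) ×
    (Σ[ G′ ∈ Graph ] Σ[ H ∈ Graph ] ∃[ r ] ∃[ rc ]
    (NonTrivial G′ × NonTrivial H × Connected G′ ×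
    IsRadius (G′ ∘ H) r × IsRainbowConnectionNumber (G′ ∘ H) rc ×
    2 ≤ r × rc ≡ 2 * r)) ×
    (Σ[ G′ ∈ Graph ] Σ[ H ∈ Graph ] ∃[ r ] ∃[ rc ]
    (NonTrivial G′ × NonTrivial H × Connected G′ ×
    IsRadius (G′ ∘ H) r × IsRainbowConnectionNumber (G′ ∘ H) rc ×
    r ≡ 1 × rc ≡ 3))
theorem3 = bounds , (Tight₁.G , Tight₁.H , Tight₁.tight) , (Tight₂.G , Tight₂.H , Tight₂.tight)
  where
  bounds : ∀ (G H : Graph) → NonTrivial G → NonTrivial H → Connected G →
           ∀ r rc → IsRadius (G ∘ H) r → IsRainbowConnectionNumber (G ∘ H) rc →
           (2 ≤ r → r ≤ rc × rc ≤ 2 * r) × (r ≡ 1 → 1 ≤ rc × rc ≤ 3)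
  bounds G H nG nH conn r rc radius number =
    -- Once `r` is replaced by 1, the lower bound `1 ≤ rc` is again `r≤rc`.
    (λ 2≤r → r≤rc , rc≤2r radius number 2≤r) , λ { refl → r≤rc , rc≤3 radius number }
    where
    open Bounds G H nG nH conn
    r≤rc = Walks.radius≤rc (G ∘ H) radius number
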